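{- If $\gamma$ is a perfectly nested circuit with $m$ internal vertices, then the partial orders $(X_\gamma,\leq_\gamma)$ and $(S_m,\leq_m)$ are isomorphic.
   Context: All graphs are simple. A circuit is a closed walk $\gamma=v_0v_1\dots v_n$ ($v_0=v_n$) with no repeated edges. If $i<j$ and $v_i=v_j$, then $v_iv_{i+1}\dots v_j$ is a sub-circuit of $\gamma$, denoted $[i,j]$; it is proper if $(i,j)\neq(0,n)$. For a proper sub-circuit $[i,j]$, the internal reduction of $\gamma$ at $i$ is the closed walk $v_0\dots v_iv_{j+1}\dots v_n$ if $i\ne 0$ and $v_j\dots v_n$ if $i=0$; the external reduction of $\gamma$ at $i$ is the closed walk $v_iv_{i+1}\dots v_j$. Write $\gamma\rightarrow_C\delta$ if $\delta$ is an (internal or external) reduction of $\gamma$ at some $i$, and let $\stackrel{*}{\rightarrow}_C$ be the reflexive transitive closure of $\rightarrow_C$. The family of reductions of $\gamma$ is $X_\gamma=\{\delta\subseteq\gamma : \gamma\stackrel{*}{\rightarrow}_C\delta\}$, and for $\xi,\eta\in X_\gamma$, $\xi\leq_\gamma\eta$ iff $\eta\stackrel{*}{\rightarrow}_C\xi$. An intersection of $\gamma=v_0\dots v_n$ is a pair $(i,j)$ with $0<i<j<n$ and $v_i=v_j$. A vertex $v$ is an internal vertex of $\gamma$ if $v=v_i=v_j$ for some intersection $(i,j)$. A circuit $\gamma=v_0v_1\dots v_n$ is a perfectly nested circuit if either it is a simple cycle (vertices appear only once, except that the first and last coincide), or there is a sequence $0=k_0<k_1<\dots<k_m<k'_m<\dots<k'_1<k'_0=n$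 with $m\ge 1$ such that: (1) the set of internal vertices of $\gamma$ is $\{v_{k_1},\dots,v_{k_m}\}$; (2) for $1\le i\le m$, $v_{k_i}$ is the vertex associated to the intersection $(k_i,k'_i)$, i.e. $v_{k_i}=v_{k'_i}$; (3) $v_{k_i}\ne v_{k_j}$ whenever $i\neq j$. $2^{\leq m}$ is the set of all binary sequences of length at most $m$ (including the empty one). For $s,t\in 2^{\le m}$, $s\sim_m t$ iff $s$ and $t$ have the same length and the same number of 1's; this is an equivalence relation, and $S_m=2^{\leq m}/\sim_m$. For $[s],[t]\in S_m$, $[s]\leq_m[t]$ iff there are $s'\in[s]$ and $t'\in[t]$ such that $s'$ extends $t'$ (i.e. $t'$ is an initial segment of $s'$).
   Formalization: In a perfectly nested circuit that is not a simple cycle, each v_{k_i} (0≤i≤m) is also required to occur only at positions k_i and k'_i; otherwise the claim fails, e.g. for x0 c x y z x u w x d x0 (m=1, more than three reductions). -}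

module Defs where

open import Level using (Level; _⊔_; 0ℓ)
open import Data.Bool.Base using (Bool)
open import Data.Fin.Base as Fin using (Fin; zero; suc; toℕ; fromℕ; inject₁)
open import Data.Fin.Properties using (toℕ<n; toℕ-fromℕ; toℕ-injective)
open import Data.List.Base as List
  using (List; _++_; length; take; drop; filterᵇ)
open import Data.List.Properties
  using (length-take; length-drop; length-++; filter-++)
open import Data.List.Relation.Binary.Pointwise using (Pointwise-≡⇒≡)
open import Data.List.Relation.Binary.Prefix.Heterogeneous
  using (Prefix; toView; _++ᵖ_) renaming (_++_ to _⧺_)
open import Data.List.Relation.Binary.Prefix.Heterogeneous.Properties
  using (length-mono; toPointwise; fromPointwise)
  renaming (trans to prefix-trans)
import Data.List.Relation.Binary.Pointwise as Pointwise
open import Data.List.Relation.Binary.Subset.Propositional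
  using () renaming (_⊆_ to _⊆ₗ_)
open import Data.Nat.Base using (ℕ; zero; suc; _+_; _∸_; _⊓_; _≤_; _<_; z≤n; s≤s)
open import Data.Nat.Properties
open import Data.Product.Base using (Σ; ∃; ∃₂; _×_; _,_; proj₁; proj₂)
open import Data.Sum.Base using (_⊎_; inj₁; inj₂)
open import Data.Vec.Base using (Vec; lookup; toList)
open import Data.Vec.Properties using (length-toList)
open import Function.Base using (id; _∘_)
open import Function.Bundles using (_⇔_)
open import Function.Definitions using (Injective)
open import Relation.Binary.Bundles using (Poset)
open import Relation.Binary.Core using (Rel)
open import Relation.Binary.Construct.Closure.ReflexiveTransitive
  using (Star; ε; _◅_; _◅◅_)
open import Relation.Binary.Morphism.Structures using (IsOrderIsomorphism)
open import Relation.Binary.PropositionalEquality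
open import Relation.Nullary.Negation using (¬_; contradiction)

private
  variable
    a ℓ ℓ₁ ℓ₂ ℓ₃ ℓ₄ ℓ₅ ℓ₆ : Level

record SimpleGraph (a ℓ : Level) : Set (Level.suc (a ⊔ ℓ)) where
  field
    Vertex : Set a
    Adj    : Rel Vertex ℓ
    symm   : ∀ {u v} → Adj u v → Adj v u
    irrefl : ∀ {v} → ¬ Adj v v

-- The sequence v₀ v₁ … vₙ; it has n + 1 entries.
record VertexSequence (V : Set a) : Set a where
  constructor mk
  field
    n        : ℕ
    vertices : Vec V (suc n)

  at : Fin (suc n) → V
  at = lookup vertices

  list : List V
  list = toList vertices

open VertexSequence public

module _ {V : Set a} where

  -- uw is the (undirected) edge vᵢvᵢ₊₁.
  IsEdge : (γ : VertexSequence V) → Fin (n γ) → V → V → Set a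
  IsEdge γ i u w = (at γ (inject₁ i) ≡ u × at γ (suc i) ≡ w)
                 ⊎ (at γ (inject₁ i) ≡ w × at γ (suc i) ≡ u)

  NoRepeatedEdges : VertexSequence V → Set a
  NoRepeatedEdges γ = ∀ i j → IsEdge γ i (at γ (inject₁ j)) (at γ (suc j)) → i ≡ j

  -- Inclusion of the subgraphs traced out: vertices and edges.
  _⊆_ : Rel (VertexSequence V) a
  δ ⊆ γ = (list δ ⊆ₗ list γ)
        × (∀ {u w} → ∃ (λ i → IsEdge δ i u w) → ∃ (λ i → IsEdge γ i u w))

  record IsSubCircuit (γ : VertexSequence V) (i j : Fin (suc (n γ))) : Set a where
    field
      i<j   : i Fin.< j
      vᵢ≡vⱼ : at γ i ≡ at γ j

  Proper : (γ : VertexSequence V) (i j : Fin (suc (n γ))) → Set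
  Proper γ i j = ¬ (i ≡ zero × j ≡ fromℕ (n γ))

  -- v₀ … vᵢ vⱼ₊₁ … vₙ if i ≠ 0, and vⱼ … vₙ if i = 0
  internal : (γ : VertexSequence V) (i j : Fin (suc (n γ))) → List V
  internal γ zero      j = drop (toℕ j) (list γ)
  internal γ i@(suc _) j = take (suc (toℕ i)) (list γ) ++ drop (suc (toℕ j)) (list γ)

  -- vᵢ vᵢ₊₁ … vⱼ
  external : (γ : VertexSequence V) (i j : Fin (suc (n γ))) → List V
  external γ i j = take (suc (toℕ j ∸ toℕ i)) (drop (toℕ i) (list γ))

  infix 4 _⟶_ _⟶*_

  data _⟶_ (γ δ : VertexSequence V) : Set a where
    internalReduction : ∀ i j → IsSubCircuit γ i j → Proper γ i j →
                        list δ ≡ internal γ i j → γ ⟶ δ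
    externalReduction : ∀ i j → IsSubCircuit γ i j → Proper γ i j →
                        list δ ≡ external γ i j → γ ⟶ δ

  _⟶*_ : Rel (VertexSequence V) a
  _⟶*_ = Star _⟶_

  Intersection : (γ : VertexSequence V) (i j : Fin (suc (n γ))) → Set a
  Intersection γ i j =
    zero {n γ} Fin.< i × i Fin.< j × j Fin.< fromℕ (n γ) × at γ i ≡ at γ j

  InternalVertex : VertexSequence V → V → Set a
  InternalVertex γ v = ∃₂ λ i j → Intersection γ i j × v ≡ at γ i × v ≡ at γ j

  record HasInternalVertices (γ : VertexSequence V) (m : ℕ) : Set a where
    field
      enum      : Fin m → V
      injective : Injective _≡_ _≡_ enum
      complete  : ∀ v → InternalVertex γ v ⇔ ∃ λ i → v ≡ enum i

  IsSimpleCycle : VertexSequence V → Set a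
  IsSimpleCycle γ = ∀ i j → i Fin.< j → at γ i ≡ at γ j → i ≡ zero × j ≡ fromℕ (n γ)

  -- k i and k′ i (0 ≤ i ≤ m) are the indices of
  -- 0 = k₀ < k₁ < … < kₘ < k′ₘ < … < k′₁ < k′₀ = n.
  --
  -- `only` makes precise that (kᵢ , k′ᵢ) is *the* intersection at v_{kᵢ} and
  -- that the base vertex v₀ is met only at the two ends.  Without it, circuits
  -- such as x₀ c x y z x u w x d x₀ or x₀ p q x₀ c x y z x w x₀ would count as
  -- nested with m = 1 though each has more than three reductions.
  record NestedIndices (γ : VertexSequence V) (m : ℕ) : Set a where
    field
      1≤m     : 1 ≤ m
      k k′    : Fin (suc m) → Fin (suc (n γ))
      k-start : k zero ≡ zero
      k-mono  : ∀ {i j} → i Fin.< j → k i Fin.< k j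
      middle  : k (fromℕ m) Fin.< k′ (fromℕ m)
      k′-anti : ∀ {i j} → i Fin.< j → k′ j Fin.< k′ i
      k′-end  : k′ zero ≡ fromℕ (n γ)
      internalVertices : ∀ v → InternalVertex γ v ⇔ ∃ λ (i : Fin m) → v ≡ at γ (k (suc i))
      intersection     : ∀ (i : Fin m) → at γ (k (suc i)) ≡ at γ (k′ (suc i))
      distinct         : ∀ {i j} → i ≢ j → at γ (k i) ≢ at γ (k j)
      only             : ∀ i p → at γ p ≡ at γ (k i) → p ≡ k i ⊎ p ≡ k′ i

  IsPerfectlyNested : VertexSequence V → Set a
  IsPerfectlyNested γ = IsSimpleCycle γ ⊎ ∃ λ m → NestedIndices γ m

module _ (G : SimpleGraph a ℓ) where
  open SimpleGraph G using (Vertex; Adj)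

  record IsClosedWalk (γ : VertexSequence Vertex) : Set (a ⊔ ℓ) where
    field
      adjacent : ∀ (i : Fin (n γ)) → Adj (at γ (inject₁ i)) (at γ (suc i))
      closed   : at γ zero ≡ at γ (fromℕ (n γ))

  record IsCircuit (γ : VertexSequence Vertex) : Set (a ⊔ ℓ) where
    field
      isClosedWalk    : IsClosedWalk γ
      noRepeatedEdges : NoRepeatedEdges γ

------------------------------------------------------------------------

-- A reduction of a closed walk is again a closed walk (and of a circuit a
-- circuit), so no such condition is imposed on δ.
record Reduction {V : Set a} (γ : VertexSequence V) : Set a where
  constructor mk
  field
    δ       : VertexSequence V
    δ⊆γ     : δ ⊆ γ
    reduces : γ ⟶* δ

module _ {V : Set a} where

  private
    len : VertexSequence V → ℕ
    len = length ∘ list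

    len≡ : ∀ γ → len γ ≡ suc (n γ)
    len≡ γ = length-toList (vertices γ)

    internal< : ∀ γ i j → i Fin.< j → length (internal γ i j) < len γ
    internal< γ zero j i<j = begin-strict
      length (drop (toℕ j) (list γ)) ≡⟨ length-drop (toℕ j) (list γ) ⟩
      len γ ∸ toℕ j                  <⟨ ∸-monoʳ-< i<j j≤ ⟩
      len γ                          ∎
      where
      open ≤-Reasoning
      j≤ : toℕ j ≤ len γ
      j≤ = subst (toℕ j ≤_) (sym (len≡ γ)) (<⇒≤ (toℕ<n j))
    internal< γ i@(suc _) j i<j = begin-strict
      length (take p vs ++ drop q vs)           ≡⟨ length-++ (take p vs) ⟩
      length (take p vs) + length (drop q vs)   ≡⟨ cong₂ _+_ (length-take p vs) (length-drop q vs) ⟩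
      p ⊓ len γ + (len γ ∸ q)   ≤⟨ +-monoˡ-≤ (len γ ∸ q) (m⊓n≤m p (len γ)) ⟩
      p + (len γ ∸ q)                           <⟨ +-monoˡ-< (len γ ∸ q) (s≤s i<j) ⟩
      q + (len γ ∸ q)                           ≡⟨ m+[n∸m]≡n q≤ ⟩
      len γ                                     ∎
      where
      open ≤-Reasoning
      vs = list γ
      p  = suc (toℕ i)
      q  = suc (toℕ j)
      q≤ : q ≤ len γ
      q≤ = subst (q ≤_) (sym (len≡ γ)) (toℕ<n j)

    length-take≤ : ∀ k (xs : List V) → length (take k xs) ≤ k
    length-take≤ k xs = subst (_≤ k) (sym (length-take k xs)) (m⊓n≤m k (length xs))

    external< : ∀ γ i j → Proper γ i j → length (external γ i j) < len γ
    external< γ zero j proper = ≤-<-trans (length-take≤ (suc (toℕ j)) (list γ))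
      (subst (suc (toℕ j) <_) (sym (len≡ γ)) (s≤s (≤∧≢⇒< (≤-pred (toℕ<n j))
        λ j≡n → proper (refl , toℕ-injective
                          (trans j≡n (sym (toℕ-fromℕ (n γ))))))))
    external< γ i@(suc i′) j proper = ≤-<-trans (length-take≤ (suc (toℕ j ∸ toℕ i)) (drop (toℕ i) (list γ)))
      (subst (suc (toℕ j ∸ toℕ i) <_) (sym (len≡ γ))
        (s≤s (lemma (toℕ j) (toℕ<n j) (toℕ i′) (toℕ<n i′))))
      where
      lemma : ∀ x {y} → x < suc y → ∀ z → z < y → x ∸ suc z < y
      lemma zero    _         z z<y = ≤-<-trans z≤n z<y
      lemma (suc x) (s≤s x<y) z _   = ≤-<-trans (m∸n≤m x z) x<y

  ⟶⇒< : ∀ {γ δ : VertexSequence V} → γ ⟶ δ → length (list δ) < length (list γ)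
  ⟶⇒< {γ} (internalReduction i j sub _ eq) =
    subst (λ xs → length xs < len γ) (sym eq) (internal< γ i j (IsSubCircuit.i<j sub))
  ⟶⇒< {γ} (externalReduction i j _ proper eq) =
    subst (λ xs → length xs < len γ) (sym eq) (external< γ i j proper)

  ⟶*⇒≤ : ∀ {γ δ : VertexSequence V} → γ ⟶* δ → length (list δ) ≤ length (list γ)
  ⟶*⇒≤ ε        = ≤-refl
  ⟶*⇒≤ (r ◅ rs) = ≤-trans (⟶*⇒≤ rs) (<⇒≤ (⟶⇒< r))

  ⟶*-antisym : ∀ {γ δ : VertexSequence V} → γ ⟶* δ → δ ⟶* γ → γ ≡ δ
  ⟶*-antisym ε        _  = refl
  ⟶*-antisym (r ◅ rs) ss =
    contradiction (≤-<-trans (≤-trans (⟶*⇒≤ ss) (⟶*⇒≤ rs)) (⟶⇒< r)) (<-irrefl refl)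

-- X_γ: two reductions are equal when they are the same closed walk, however
-- they were obtained.
X : {V : Set a} → VertexSequence V → Poset a a a
X γ = record
  { Carrier        = Reduction γ
  ; _≈_            = λ ξ η → Reduction.δ ξ ≡ Reduction.δ η
  ; _≤_            = λ ξ η → Reduction.δ η ⟶* Reduction.δ ξ
  ; isPartialOrder = record
    { isPreorder = record
      { isEquivalence = record { refl = refl ; sym = sym ; trans = trans }
      ; reflexive     = λ { refl → ε }
      ; trans         = λ ξ≤η η≤ζ → η≤ζ ◅◅ ξ≤η
      }
    ; antisym = λ ξ≤η η≤ξ → ⟶*-antisym η≤ξ ξ≤η
    }
  }

------------------------------------------------------------------------

2^≤ : ℕ → Set
2^≤ m = Σ (List Bool) λ s → length s ≤ m

ones : List Bool → ℕ
ones s = length (filterᵇ id s)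

module _ {m : ℕ} where

  infix 4 _∼_ _extends_ _≼_

  _∼_ : Rel (2^≤ m) 0ℓ
  (s , _) ∼ (t , _) = length s ≡ length t × ones s ≡ ones t

  _extends_ : Rel (2^≤ m) 0ℓ
  (s , _) extends (t , _) = Prefix _≡_ t s

  _≼_ : Rel (2^≤ m) 0ℓ
  s ≼ t = ∃₂ λ s′ t′ → s′ ∼ s × t′ ∼ t × s′ extends t′

  private
    ∼-sym : ∀ {s t} → s ∼ t → t ∼ s
    ∼-sym (p , q) = sym p , sym q

    ∼-trans : ∀ {s t u} → s ∼ t → t ∼ u → s ∼ u
    ∼-trans (p , q) (p′ , q′) = trans p p′ , trans q q′

    ≼-reflexive : ∀ {s t} → s ∼ t → s ≼ t
    ≼-reflexive {s} s∼t =
      s , s , (refl , refl) , s∼t , fromPointwise (Pointwise.refl refl)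

    ones-++ : ∀ s t → ones (s ++ t) ≡ ones s + ones t
    ones-++ s t = trans (cong length (filter-++ _ s t)) (length-++ (filterᵇ id s))

    extends-cong : ∀ {s t u} → s extends t → u ∼ t → ∃ λ v → v ∼ s × v extends u
    extends-cong {s , s≤m} {t , _} {u , _} t⊑s (p , q) with toView t⊑s
    ... | t≡ ⧺ r with refl ← Pointwise-≡⇒≡ t≡ =
      (u ++ r , subst (_≤ m) (sym len) s≤m) , (len , one)
        , fromPointwise (Pointwise.refl refl) ++ᵖ r
      where
      len : length (u ++ r) ≡ length (t ++ r)
      len = trans (length-++ u) (trans (cong (_+ length r) p) (sym (length-++ t)))
      one : ones (u ++ r) ≡ ones (t ++ r)
      one = trans (ones-++ u r) (trans (cong (_+ ones r) q) (sym (ones-++ t r)))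

    ≼-trans : ∀ {s t u} → s ≼ t → t ≼ u → s ≼ u
    ≼-trans {s} {t} {u} (s′ , t′ , s′∼s , t′∼t , t′⊑s′) (t″ , u′ , t″∼t , u′∼u , u′⊑t″)
      with s″ , s″∼s′ , t″⊑s″ ← extends-cong {s′} {t′} {t″} t′⊑s′
                                  (∼-trans {t″} {t} {t′} t″∼t (∼-sym {t′} {t} t′∼t))
      = s″ , u′ , ∼-trans {s″} {s′} {s} s″∼s′ s′∼s , u′∼u , prefix-trans trans u′⊑t″ t″⊑s″

    ≼⇒length≥ : ∀ {s t} → s ≼ t → length (proj₁ t) ≤ length (proj₁ s)
    ≼⇒length≥ (_ , _ , (p , _) , (q , _) , t′⊑s′) = subst₂ _≤_ q p (length-mono t′⊑s′)

    ≼-antisym : ∀ {s t} → s ≼ t → t ≼ s → s ∼ t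
    ≼-antisym {s} {t} s≼t@(_ , _ , (p , p′) , (q , q′) , t′⊑s′) t≼s =
      len , trans (sym p′) (trans (cong ones (sym t′≡s′)) q′)
      where
      len   = ≤-antisym (≼⇒length≥ {t} {s} t≼s) (≼⇒length≥ {s} {t} s≼t)
      t′≡s′ = Pointwise-≡⇒≡ (toPointwise (trans q (trans (sym len) (sym p))) t′⊑s′)

  S-poset : Poset 0ℓ 0ℓ 0ℓ
  S-poset = record
    { Carrier        = 2^≤ m
    ; _≈_            = _∼_
    ; _≤_            = _≼_
    ; isPartialOrder = record
      { isPreorder = record
        { isEquivalence = record
          { refl  = refl , refl
          ; sym   = λ {s} {t} → ∼-sym {s} {t}
          ; trans = λ {s} {t} {u} → ∼-trans {s} {t} {u}
          }
        ; reflexive = λ {s} {t} → ≼-reflexive {s} {t}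
        ; trans     = λ {s} {t} {u} → ≼-trans {s} {t} {u}
        }
      ; antisym = λ {s} {t} → ≼-antisym {s} {t}
      }
    }

-- The quotient 2^≤ m / ∼, as a setoid.
S : ℕ → Poset 0ℓ 0ℓ 0ℓ
S m = S-poset {m}

------------------------------------------------------------------------

Isomorphic : Poset ℓ₁ ℓ₂ ℓ₃ → Poset ℓ₄ ℓ₅ ℓ₆ → Set (ℓ₁ ⊔ ℓ₂ ⊔ ℓ₃ ⊔ ℓ₄ ⊔ ℓ₅ ⊔ ℓ₆)
Isomorphic P Q = ∃ λ f → IsOrderIsomorphism P._≈_ Q._≈_ P._≤_ Q._≤_ f
  where
  module P = Poset P
  module Q = Poset Q

{-# OPTIONS --safe #-}

-- Cutting γ at the positions kᵢ , k′ᵢ decomposes it into m + 1 consecutive levels,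
-- the i-th consisting of the parts kᵢ … kᵢ₊₁ and k′ᵢ₊₁ … k′ᵢ (the last one of the
-- part kₘ … k′ₘ).  An internal reduction at kᵢ removes the levels i, i + 1, …, and
-- an external one those before i.  Hence the reductions of γ are the nonempty
-- intervals of levels, ordered by inclusion, and the interval a, …, c − 1
-- corresponds to the class of the sequences with a ones and m + 1 − c zeros.
module Submission where

open import Defs
open import Level using (Level)
open import Data.Bool.Base using (Bool; true; false)
open import Data.Fin.Base as Fin using (Fin; zero; suc; toℕ; fromℕ; fromℕ<; inject₁)
open import Data.Fin.Properties
  using (toℕ<n; toℕ-fromℕ; toℕ-fromℕ<; toℕ-injective; ≤fromℕ; cantor-schröder-bernstein)
  renaming (_≟_ to _≟ᶠ_; suc-injective to sucᶠ-injective)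
open import Data.List.Base using (List; []; _∷_; [_]; _++_; map; take; drop; length; iterate; replicate; filterᵇ)
open import Data.List.Membership.Propositional using (_∈_)
open import Data.List.Membership.Propositional.Properties using (∈-++⁺ˡ; ∈-++⁺ʳ; ∈-++⁻)
open import Data.List.Properties
open import Data.List.Relation.Binary.Pointwise using (Pointwise-≡⇒≡)
import Data.List.Relation.Binary.Pointwise as Pointwise
open import Data.List.Relation.Binary.Prefix.Heterogeneous using (toView; _++ᵖ_)
  renaming (_++_ to _⧺_)
open import Data.List.Relation.Binary.Prefix.Heterogeneous.Properties using (fromPointwise)
open import Data.List.Relation.Binary.Subset.Propositional using () renaming (_⊆_ to _⊆ₗ_)
open import Data.List.Relation.Unary.All as All using (All; []; _∷_)
import Data.List.Relation.Unary.All.Properties as All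
open import Data.List.Relation.Unary.AllPairs using (AllPairs; []; _∷_)
import Data.List.Relation.Unary.AllPairs.Properties as AllPairs
open import Data.Nat.Base using (ℕ; zero; suc; _+_; _∸_; _≤_; _<_; z≤n; s≤s; s≤s⁻¹)
open import Data.Nat.Properties
open import Data.Nat.Tactic.RingSolver using (solve-∀)
open import Data.Product.Base using (∃; ∃₂; _×_; _,_; proj₁; proj₂)
open import Data.Sum.Base as Sum using (_⊎_; inj₁; inj₂)
open import Data.Vec.Base as Vec using (Vec; []; _∷_; lookup; toList; fromList)
open import Data.Vec.Properties using (length-toList; toList∘fromList; toList-injective; cast-is-id)
open import Function.Base using (id; _∘_)
open import Function.Bundles using (Equivalence)
open import Relation.Binary.Bundles using (Poset)
open import Relation.Binary.Construct.Closure.ReflexiveTransitive using (ε; _◅_; _◅◅_)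
open import Relation.Binary.Core using (Rel)
open import Relation.Binary.Definitions using (tri<; tri≈; tri>)
open import Relation.Binary.PropositionalEquality hiding ([_])
open import Relation.Nullary.Decidable using (yes; no)
open import Relation.Nullary.Negation using (¬_; contradiction)

-- Every step of a reduction renumbers the entries, so indices into the intermediate sequences do
-- not survive an induction. A reduction is therefore recorded by an increasing list of positions of
-- `γ`: vertices may repeat along a walk, positions cannot. A repeated vertex of a reduction is then
-- a repetition in `γ` itself, hence a pair `K l`, `K′ l`, and a single reduction merely moves one
-- end of the interval of levels to `l`. On the other side, a sequence has a 1 for each outer level
-- removed and a 0 for each inner one; at least one of the m + 1 levels stays, whence the bound m on
-- the length. Removals at the two ends are independent of each other, and letters of a class may be
-- reordered, so in both orders the smaller element is the one with at least as many 1's and at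
-- least as many 0's.

private
  variable
    a b : Level
    A : Set a
    B : Set b

-- Cutting lists and vectors at given entries.

drop-length-++ : ∀ (xs : List A) {ys} k → drop (length xs + k) (xs ++ ys) ≡ drop k ys
drop-length-++ []       k = refl
drop-length-++ (x ∷ xs) k = drop-length-++ xs k

take-suc-length-++ : ∀ (xs : List A) {y ys} → take (suc (length xs)) (xs ++ y ∷ ys) ≡ xs ++ [ y ]
take-suc-length-++ []       = refl
take-suc-length-++ (x ∷ xs) = cong (x ∷_) (take-suc-length-++ xs)

drop-suc-length-++ : ∀ (xs : List A) {y ys} → drop (suc (length xs)) (xs ++ y ∷ ys) ≡ ys
drop-suc-length-++ []       = refl
drop-suc-length-++ (x ∷ xs) = drop-suc-length-++ xs

length-++-∷-++-∷ : ∀ (P : List A) x R y Q →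
  length (P ++ x ∷ R ++ y ∷ Q) ≡ suc (length P + suc (length R) + length Q)
length-++-∷-++-∷ P x R y Q = begin
  length (P ++ x ∷ R ++ y ∷ Q)                   ≡⟨ length-++ P ⟩
  length P + suc (length (R ++ y ∷ Q))           ≡⟨ cong (λ k → length P + suc k) (length-++ R) ⟩
  length P + suc (length R + suc (length Q))     ≡⟨ cong (λ k → length P + suc k) (+-suc (length R) _) ⟩
  length P + suc (suc (length R + length Q))     ≡⟨ +-suc (length P) _ ⟩
  suc (length P + (suc (length R) + length Q))   ≡⟨ cong suc (sym (+-assoc (length P) _ _)) ⟩
  suc (length P + suc (length R) + length Q)     ∎
  where open ≡-Reasoning

map-split : ∀ (f : A → B) zs P {x Q} → map f zs ≡ P ++ x ∷ Q →
  ∃₂ λ P′ i → ∃ λ Q′ → zs ≡ P′ ++ i ∷ Q′ × P ≡ map f P′ × x ≡ f i × Q ≡ map f Q′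
map-split f (z ∷ zs) []      refl = [] , z , zs , refl , refl , refl , refl
map-split f (z ∷ zs) (p ∷ P) eq
  with P′ , i , Q′ , zs≡ , P≡ , x≡ , Q≡ ← map-split f zs P (∷-injectiveʳ eq) =
  z ∷ P′ , i , Q′ , cong (z ∷_) zs≡ , cong₂ _∷_ (sym (∷-injectiveˡ eq)) P≡ , x≡ , Q≡

lookup-split : ∀ {k} (vs : Vec A k) i → ∃₂ λ P Q →
  toList vs ≡ P ++ lookup vs i ∷ Q × toℕ i ≡ length P
lookup-split (x ∷ vs) zero = [] , toList vs , refl , refl
lookup-split (x ∷ vs) (suc i) with P , Q , eq , i≡ ← lookup-split vs i =
  x ∷ P , Q , cong (x ∷_) eq , cong suc i≡

lookup-split₂ : ∀ {k} (vs : Vec A k) i j → i Fin.< j → ∃₂ λ P R → ∃ λ Q →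
  toList vs ≡ P ++ lookup vs i ∷ R ++ lookup vs j ∷ Q ×
  toℕ i ≡ length P × toℕ j ≡ length P + suc (length R)
lookup-split₂ (x ∷ vs) zero (suc j) _ with R , Q , eq , j≡ ← lookup-split vs j =
  [] , R , Q , cong (x ∷_) eq , refl , cong suc j≡
lookup-split₂ (x ∷ vs) (suc i) (suc j) (s≤s i<j)
  with P , R , Q , eq , i≡ , j≡ ← lookup-split₂ vs i j i<j =
  x ∷ P , R , Q , cong (x ∷_) eq , cong suc i≡ , cong suc j≡

split-lookup : ∀ {k} (vs : Vec A k) P {x Q} → toList vs ≡ P ++ x ∷ Q →
  ∃ λ i → toℕ i ≡ length P × lookup vs i ≡ x
split-lookup (v ∷ vs) []      refl = zero , refl , refl
split-lookup (v ∷ vs) (p ∷ P) eq with i , i≡ , x≡ ← split-lookup vs P (∷-injectiveʳ eq) =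
  suc i , cong suc i≡ , x≡

-- The field `n` is recovered from the length of the list, so sequences can be compared as lists.
list-injective : {V : Set a} {γ δ : VertexSequence V} → list γ ≡ list δ → γ ≡ δ
list-injective {γ = γ} {δ} eq = go (vertices γ) (vertices δ) eq
  (suc-injective (trans (sym (length-toList (vertices γ)))
    (trans (cong length eq) (length-toList (vertices δ)))))
  where
  go : ∀ {k l} (xs : Vec _ (suc k)) (ys : Vec _ (suc l)) → toList xs ≡ toList ys → k ≡ l →
       _≡_ {A = VertexSequence _} (mk k xs) (mk l ys)
  go xs ys eq refl = cong (mk _) (trans (sym (cast-is-id refl xs)) (toList-injective refl xs ys eq))

-- Reductions at the level of lists

module _ {V : Set a} where

  infix 4 _↝_

  -- The cases i = 0 and i ≠ 0 of `internal` merge in this form, since `P = []` already gives the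
  -- walk starting at vⱼ. The side condition on `P` and `Q` is `Proper`.
  data _↝_ : Rel (List V) a where
    int : ∀ P x R Q → ¬ (P ≡ [] × Q ≡ []) → P ++ x ∷ R ++ x ∷ Q ↝ P ++ x ∷ Q
    ext : ∀ P x R Q → ¬ (P ≡ [] × Q ≡ []) → P ++ x ∷ R ++ x ∷ Q ↝ x ∷ R ++ [ x ]

  external≡ : ∀ (γ : VertexSequence V) P {x} R {Q} {i j : Fin (suc (n γ))} → list γ ≡ P ++ x ∷ R ++ x ∷ Q →
              toℕ i ≡ length P → toℕ j ≡ length P + suc (length R) → external γ i j ≡ x ∷ R ++ [ x ]
  external≡ γ P {x} R {Q} γ≡ i≡ j≡ rewrite γ≡ | i≡ | j≡ | m+n∸m≡n (length P) (suc (length R))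
    | trans (cong (λ k → drop k (P ++ x ∷ R ++ x ∷ Q)) (sym (+-identityʳ (length P))))
            (drop-length-++ P {x ∷ R ++ x ∷ Q} 0)
    = cong (x ∷_) (take-suc-length-++ R)

  internal≡ : ∀ (γ : VertexSequence V) P {x} R {Q} {i j : Fin (suc (n γ))} → list γ ≡ P ++ x ∷ R ++ x ∷ Q →
              toℕ i ≡ length P → toℕ j ≡ length P + suc (length R) → internal γ i j ≡ P ++ x ∷ Q
  internal≡ γ [] {x} R {Q} {zero} γ≡ i≡ j≡ rewrite γ≡ | j≡ =
    trans (cong (λ k → drop k (R ++ x ∷ Q)) (sym (+-identityʳ (length R)))) (drop-length-++ R 0)
  internal≡ γ P@(_ ∷ _) {x} R {Q} {suc i} γ≡ i≡ j≡ rewrite γ≡ | i≡ | j≡ =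
    trans (cong₂ _++_ (take-suc-length-++ P) drop≡) (++-assoc P [ x ] Q)
    where
    drop≡ : drop (suc (length P + suc (length R))) (P ++ x ∷ R ++ x ∷ Q) ≡ Q
    drop≡ = trans (cong (λ k → drop k (P ++ x ∷ R ++ x ∷ Q)) (sym (+-suc (length P) _)))
      (trans (drop-length-++ P _) (drop-suc-length-++ R))

  n≡split-length : ∀ (γ : VertexSequence V) P {x} R {y Q} → list γ ≡ P ++ x ∷ R ++ y ∷ Q →
    n γ ≡ length P + suc (length R) + length Q
  n≡split-length γ P {x} R {y} {Q} γ≡ = suc-injective (begin
    suc (n γ)                                     ≡⟨ sym (length-toList (vertices γ)) ⟩
    length (list γ)                               ≡⟨ cong length γ≡ ⟩
    length (P ++ x ∷ R ++ y ∷ Q)                  ≡⟨ length-++-∷-++-∷ P x R y Q ⟩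
    suc (length P + suc (length R) + length Q)    ∎)
    where open ≡-Reasoning

  subCircuit-split : ∀ (γ : VertexSequence V) i j → IsSubCircuit γ i j → Proper γ i j →
    ∃₂ λ P x → ∃₂ λ R Q →
    list γ ≡ P ++ x ∷ R ++ x ∷ Q × toℕ i ≡ length P × toℕ j ≡ length P + suc (length R) ×
    ¬ (P ≡ [] × Q ≡ [])
  subCircuit-split γ i j sub proper
    with P , R , Q , γ≡ , i≡ , j≡ ← lookup-split₂ (vertices γ) i j (IsSubCircuit.i<j sub)
    rewrite sym (IsSubCircuit.vᵢ≡vⱼ sub) =
    P , at γ i , R , Q , γ≡ , i≡ , j≡ , λ { (refl , refl) → proper
      (toℕ-injective i≡ , toℕ-injective (begin
        toℕ j                 ≡⟨ j≡ ⟩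
        suc (length R)        ≡⟨ sym (+-identityʳ _) ⟩
        suc (length R) + 0    ≡⟨ sym (n≡split-length γ [] R γ≡) ⟩
        n γ                   ≡⟨ sym (toℕ-fromℕ (n γ)) ⟩
        toℕ (fromℕ (n γ))     ∎)) }
    where open ≡-Reasoning

  ⟶⇒↝ : ∀ {γ δ : VertexSequence V} → γ ⟶ δ → list γ ↝ list δ
  ⟶⇒↝ {γ} {δ} (internalReduction i j sub proper δ≡)
    with P , x , R , Q , γ≡ , i≡ , j≡ , ne ← subCircuit-split γ i j sub proper =
    subst₂ _↝_ (sym γ≡) (sym (trans δ≡ (internal≡ γ P R γ≡ i≡ j≡))) (int P x R Q ne)
  ⟶⇒↝ {γ} {δ} (externalReduction i j sub proper δ≡)
    with P , x , R , Q , γ≡ , i≡ , j≡ , ne ← subCircuit-split γ i j sub proper =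
    subst₂ _↝_ (sym γ≡) (sym (trans δ≡ (external≡ γ P R γ≡ i≡ j≡))) (ext P x R Q ne)

  split-subCircuit : ∀ (γ : VertexSequence V) P {x} R {Q} → list γ ≡ P ++ x ∷ R ++ x ∷ Q → ¬ (P ≡ [] × Q ≡ []) →
    ∃₂ λ i j → IsSubCircuit γ i j × Proper γ i j ×
               toℕ i ≡ length P × toℕ j ≡ length P + suc (length R)
  split-subCircuit γ P {x} R {Q} γ≡ ne
    with i , i≡ , vᵢ≡ ← split-lookup (vertices γ) P γ≡
    with j , j≡′ , vⱼ≡ ← split-lookup (vertices γ) (P ++ x ∷ R) (trans γ≡ (sym (++-assoc P (x ∷ R) (x ∷ Q))))
    = i , j , record { i<j = subst₂ _<_ (sym i≡) (sym j≡) (m<m+n (length P) (s≤s z≤n))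
                     ; vᵢ≡vⱼ = trans vᵢ≡ (sym vⱼ≡) }
      , (λ { (refl , refl) → ne (length≡0 P (sym i≡) , length≡0 Q (Q-length j≡)) })
      , i≡ , j≡
    where
    j≡ = trans j≡′ (length-++ P)
    length≡0 : ∀ (xs : List V) → length xs ≡ 0 → xs ≡ []
    length≡0 [] _ = refl
    Q-length : toℕ (fromℕ (n γ)) ≡ length P + suc (length R) → length Q ≡ 0
    Q-length n≡ = +-cancelˡ-≡ (length P + suc (length R)) _ 0 (begin
      length P + suc (length R) + length Q ≡⟨ sym (n≡split-length γ P R γ≡) ⟩
      n γ                                  ≡⟨ sym (toℕ-fromℕ (n γ)) ⟩
      toℕ (fromℕ (n γ))                    ≡⟨ n≡ ⟩
      length P + suc (length R)            ≡⟨ sym (+-identityʳ _) ⟩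
      length P + suc (length R) + 0        ∎)
      where open ≡-Reasoning

  ↝⇒⟶ : ∀ {γ δ : VertexSequence V} {xs ys} → list γ ≡ xs → list δ ≡ ys → xs ↝ ys → γ ⟶ δ
  ↝⇒⟶ {γ} γ≡ δ≡ (int P x R Q ne)
    with i , j , sub , proper , i≡ , j≡ ← split-subCircuit γ P R γ≡ ne =
    internalReduction i j sub proper (trans δ≡ (sym (internal≡ γ P R γ≡ i≡ j≡)))
  ↝⇒⟶ {γ} γ≡ δ≡ (ext P x R Q ne)
    with i , j , sub , proper , i≡ , j≡ ← split-subCircuit γ P R γ≡ ne =
    externalReduction i j sub proper (trans δ≡ (sym (external≡ γ P R γ≡ i≡ j≡)))

  -- The subgraph traced out by a reduction.

  -- Steps are oriented here: both reductions keep the direction of travel, so undirected edges need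
  -- only a swap at the end.
  data Consecutive (u w : V) : List V → Set a where
    here  : ∀ {xs} → Consecutive u w (u ∷ w ∷ xs)
    there : ∀ {x xs} → Consecutive u w xs → Consecutive u w (x ∷ xs)

  lookup-consecutive : ∀ {k} (vs : Vec V (suc k)) i →
    Consecutive (lookup vs (inject₁ i)) (lookup vs (suc i)) (toList vs)
  lookup-consecutive (_ ∷ _ ∷ _)  zero    = here
  lookup-consecutive (_ ∷ y ∷ vs) (suc i) = there (lookup-consecutive (y ∷ vs) i)

  consecutive-lookup : ∀ {k u w} (vs : Vec V (suc k)) → Consecutive u w (toList vs) →
    ∃ λ i → lookup vs (inject₁ i) ≡ u × lookup vs (suc i) ≡ w
  consecutive-lookup (_ ∷ _ ∷ _)  here = zero , refl , refl
  consecutive-lookup (_ ∷ y ∷ vs) (there c) with i , eqs ← consecutive-lookup (y ∷ vs) c = suc i , eqs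
  consecutive-lookup (_ ∷ [])     (there ())

  consecutive-++⁺ˡ : ∀ {u w xs ys} → Consecutive u w xs → Consecutive u w (xs ++ ys)
  consecutive-++⁺ˡ here      = here
  consecutive-++⁺ˡ (there c) = there (consecutive-++⁺ˡ c)

  consecutive-++⁺ʳ : ∀ {u w} xs {ys} → Consecutive u w ys → Consecutive u w (xs ++ ys)
  consecutive-++⁺ʳ []       c = c
  consecutive-++⁺ʳ (x ∷ xs) c = there (consecutive-++⁺ʳ xs c)

  consecutive-++⁻ : ∀ {u w} P {x Q} → Consecutive u w (P ++ x ∷ Q) →
    Consecutive u w (P ++ [ x ]) ⊎ Consecutive u w (x ∷ Q)
  consecutive-++⁻ []          c         = inj₂ c
  consecutive-++⁻ (_ ∷ [])    here      = inj₁ here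
  consecutive-++⁻ (_ ∷ [])    (there c) = inj₂ c
  consecutive-++⁻ (_ ∷ _ ∷ P) here      = inj₁ here
  consecutive-++⁻ (_ ∷ q ∷ P) (there c) = Sum.map₁ there (consecutive-++⁻ (q ∷ P) c)

  ↝-∈ : ∀ {xs ys} → xs ↝ ys → ys ⊆ₗ xs
  ↝-∈ (int P x R Q _) v∈ with ∈-++⁻ P v∈
  ... | inj₁ v∈P = ∈-++⁺ˡ v∈P
  ... | inj₂ v∈Q = ∈-++⁺ʳ P (∈-++⁺ʳ (x ∷ R) v∈Q)
  ↝-∈ (ext P x R Q _) {v} v∈ =
    ∈-++⁺ʳ P (subst (v ∈_) (++-assoc (x ∷ R) [ x ] Q) (∈-++⁺ˡ v∈))

  -- An internal reduction splices at two visits to the same vertex `x`, so no new edge arises: each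
  -- step of the result lies wholly before or wholly after the splice.
  ↝-consecutive : ∀ {xs ys u w} → xs ↝ ys → Consecutive u w ys → Consecutive u w xs
  ↝-consecutive (int P x R Q _) c with consecutive-++⁻ P c
  ... | inj₁ c′ = subst (Consecutive _ _) (++-assoc P [ x ] (R ++ x ∷ Q)) (consecutive-++⁺ˡ c′)
  ... | inj₂ c′ = consecutive-++⁺ʳ P (consecutive-++⁺ʳ (x ∷ R) c′)
  ↝-consecutive (ext P x R Q _) c =
    consecutive-++⁺ʳ P (subst (Consecutive _ _) (++-assoc (x ∷ R) [ x ] Q) (consecutive-++⁺ˡ c))

  ⟶⇒⊇ : ∀ {γ δ : VertexSequence V} → γ ⟶ δ → δ ⊆ γ
  ⟶⇒⊇ {γ} {δ} r = ↝-∈ (⟶⇒↝ r) , λ { (i , inj₁ (refl , refl)) → edge i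
                                   ; (i , inj₂ (refl , refl)) → flip (edge i) }
    where
    edge : ∀ i → ∃ λ j → IsEdge γ j (at δ (inject₁ i)) (at δ (suc i))
    edge i with j , eqs ← consecutive-lookup (vertices γ)
                            (↝-consecutive (⟶⇒↝ r) (lookup-consecutive (vertices δ) i)) = j , inj₁ eqs
    flip : ∀ {u w} → (∃ λ j → IsEdge γ j u w) → ∃ λ j → IsEdge γ j w u
    flip (j , e) = j , Sum.swap e

  -- Supplies the inclusion carried by an element of `X γ`, so that surjectivity can build elements
  -- from reduction sequences.
  ⟶*⇒⊇ : ∀ {γ δ : VertexSequence V} → γ ⟶* δ → δ ⊆ γ
  ⟶*⇒⊇ ε        = id , id
  ⟶*⇒⊇ (r ◅ rs) = proj₁ (⟶⇒⊇ r) ∘ proj₁ (⟶*⇒⊇ rs) , proj₂ (⟶⇒⊇ r) ∘ proj₂ (⟶*⇒⊇ rs)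

-- Ranges of positions

infix 6 _⋯<_ _⋯_

-- The length `suc (q ∸ p)` lets `p ⋯ q` compute to `p ∷ suc p ⋯< suc q`; the splittings of walks
-- below use this silently.
_⋯<_ _⋯_ : ℕ → ℕ → List ℕ
p ⋯< q = iterate suc p (q ∸ p)
p ⋯ q = iterate suc p (suc (q ∸ p))

iterate-suc-++ : ∀ p d e → iterate suc p d ++ iterate suc (p + d) e ≡ iterate suc p (d + e)
iterate-suc-++ p zero    e = cong (λ r → iterate suc r e) (+-identityʳ p)
iterate-suc-++ p (suc d) e = cong (p ∷_)
  (trans (cong (λ r → iterate suc (suc p) d ++ iterate suc r e) (+-suc p d)) (iterate-suc-++ (suc p) d e))

private
  ∸-split : ∀ {p q r} → p ≤ q → q ≤ r → (q ∸ p) + (r ∸ q) ≡ r ∸ p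
  ∸-split {p} {q} {r} p≤q q≤r =
    trans (sym (+-∸-comm (r ∸ q) p≤q)) (cong (_∸ p) (m+[n∸m]≡n q≤r))

⋯<-++-⋯< : ∀ {p q r} → p ≤ q → q ≤ r → p ⋯< q ++ q ⋯< r ≡ p ⋯< r
⋯<-++-⋯< {p} {q} {r} p≤q q≤r = begin
  p ⋯< q ++ q ⋯< r                                ≡⟨ cong (λ s → p ⋯< q ++ iterate suc s (r ∸ q)) (sym (m+[n∸m]≡n p≤q)) ⟩
  p ⋯< q ++ iterate suc (p + (q ∸ p)) (r ∸ q)        ≡⟨ iterate-suc-++ p (q ∸ p) (r ∸ q) ⟩
  iterate suc p ((q ∸ p) + (r ∸ q))                     ≡⟨ cong (iterate suc p) (∸-split p≤q q≤r) ⟩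
  p ⋯< r                                             ∎
  where open ≡-Reasoning

⋯≡⋯< : ∀ {p q} → p ≤ q → p ⋯ q ≡ p ⋯< suc q
⋯≡⋯< {p} p≤q = cong (iterate suc p) (sym (+-∸-assoc 1 p≤q))

⋯<-++-⋯ : ∀ {p q r} → p ≤ q → q ≤ r → p ⋯< q ++ q ⋯ r ≡ p ⋯ r
⋯<-++-⋯ {p} {q} p≤q q≤r = trans (cong (p ⋯< q ++_) (⋯≡⋯< q≤r))
  (trans (⋯<-++-⋯< p≤q (m≤n⇒m≤1+n q≤r)) (sym (⋯≡⋯< (≤-trans p≤q q≤r))))

⋯<-empty : ∀ p → p ⋯< p ≡ []
⋯<-empty p = cong (iterate suc p) (n∸n≡0 p)

⋯<-head : ∀ {p q} → p < q → p ⋯< q ≡ p ∷ suc p ⋯< q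
⋯<-head {p} {suc q} (s≤s p≤q) = cong (iterate suc p) (+-∸-assoc 1 p≤q)

⋯<-bounds : ∀ p q → All (λ x → p ≤ x × x < q) (p ⋯< q)
⋯<-bounds p q with ≤-total p q
... | inj₂ q≤p rewrite m≤n⇒m∸n≡0 q≤p = []
... | inj₁ p≤q = subst (λ r → All (λ x → p ≤ x × x < r) (p ⋯< q)) (m+[n∸m]≡n p≤q) (go p (q ∸ p))
  where
  go : ∀ p d → All (λ x → p ≤ x × x < p + d) (iterate suc p d)
  go p zero    = []
  go p (suc d) = (≤-refl , m<m+n p (s≤s z≤n)) ∷
    All.map (λ {x} (p<x , x<) → <⇒≤ p<x , subst (x <_) (sym (+-suc p d)) x<) (go (suc p) d)

⋯-bounds : ∀ {p q} → p ≤ q → All (λ x → p ≤ x × x ≤ q) (p ⋯ q)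
⋯-bounds {p} {q} p≤q = subst (All _) (sym (⋯≡⋯< p≤q))
  (All.map (λ (p≤x , x<) → p≤x , s≤s⁻¹ x<) (⋯<-bounds p (suc q)))

iterate-suc-sorted : ∀ p d → AllPairs _<_ (iterate suc p d)
iterate-suc-sorted p zero    = []
iterate-suc-sorted p (suc d) =
  All.map proj₁ (subst (λ e → All (λ x → suc p ≤ x × x < suc p + d) (iterate suc (suc p) e))
                       (m+n∸m≡n p d) (⋯<-bounds (suc p) (suc p + d)))
  ∷ iterate-suc-sorted (suc p) d

sorted-after : ∀ P {i Q} → AllPairs _<_ (P ++ i ∷ Q) → All (i <_) Q
sorted-after []      (i<Q ∷ _) = i<Q
sorted-after (p ∷ P) (_ ∷ s)   = sorted-after P s

-- In a strictly increasing list an entry occurs only once, so it determines what precedes and what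
-- follows it. For the vertices of a walk this would fail.
sorted-split-unique : ∀ P P′ {i Q Q′} → AllPairs _<_ (P ++ i ∷ Q) → P ++ i ∷ Q ≡ P′ ++ i ∷ Q′ →
                      P ≡ P′ × Q ≡ Q′
sorted-split-unique []      []       _         refl = refl , refl
sorted-split-unique []      (_ ∷ P′) (i<Q ∷ _) refl =
  contradiction (All.head (All.++⁻ʳ P′ i<Q)) (<-irrefl refl)
sorted-split-unique (_ ∷ P) []       (p<Q ∷ _) refl =
  contradiction (All.head (All.++⁻ʳ P p<Q)) (<-irrefl refl)
sorted-split-unique (p ∷ P) (p′ ∷ P′) (_ ∷ s) eq
  with refl , eq′ ← ∷-injective eq
  with refl , refl ← sorted-split-unique P P′ s eq′ = refl , refl

-- The reductions of a nested circuit

-- Compared with NestedIndices there is one more level, at which the two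
-- sequences of positions meet: K (m + 1) = K′ (m + 1).
record Nesting {V : Set a} (v : ℕ → V) (n m : ℕ) : Set a where
  field
    K K′    : ℕ → ℕ
    K-start : K 0 ≡ 0
    K′-end  : K′ 0 ≡ n
    K-mono  : ∀ {i j} → i < j → j ≤ suc m → K i < K j
    K′-anti : ∀ {i j} → i ≤ j → j ≤ suc m → K′ j ≤ K′ i
    K-top   : K (suc m) ≡ K′ (suc m)
    match   : ∀ {l} → l ≤ m → v (K l) ≡ v (K′ l)
    only    : ∀ {p q} → p < q → q ≤ n → v p ≡ v q → ∃ λ l → l ≤ m × p ≡ K l × q ≡ K′ l

module _ {V : Set a} {v : ℕ → V} {n m : ℕ} (N : Nesting v n m) where
  open Nesting N

  K-mono-≤ : ∀ {i j} → i ≤ j → j ≤ suc m → K i ≤ K j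
  K-mono-≤ i≤j j≤ with m≤n⇒m<n∨m≡n i≤j
  ... | inj₁ i<j  = <⇒≤ (K-mono i<j j≤)
  ... | inj₂ refl = ≤-refl

  K≤K′ : ∀ {i j} → i ≤ suc m → j ≤ suc m → K i ≤ K′ j
  K≤K′ i≤ j≤ = ≤-trans (K-mono-≤ i≤ ≤-refl) (≤-trans (≤-reflexive K-top) (K′-anti j≤ ≤-refl))

  K<K′ : ∀ {i j} → i ≤ m → j ≤ suc m → K i < K′ j
  K<K′ i≤m j≤ = <-≤-trans (K-mono (s≤s i≤m) ≤-refl) (K≤K′ ≤-refl j≤)

  K′≤n : ∀ {i} → i ≤ suc m → K′ i ≤ n
  K′≤n i≤ = ≤-trans (K′-anti z≤n i≤) (≤-reflexive K′-end)

  -- The reduction of γ consisting of the levels a, …, c − 1: the part of γ from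
  -- K a to K′ a with the part from K c to K′ c cut out.
  positions : ℕ → ℕ → List ℕ
  positions a c = K a ⋯< K c ++ K′ c ⋯ K′ a

  walk : ℕ → ℕ → List V
  walk a c = map v (positions a c)

  -- What `walk a c` traverses strictly between its two visits to level `l`, for a ≤ l < c: the `R`
  -- of a reduction there. It does not depend on `a`.
  between : ℕ → ℕ → List ℕ
  between l c = suc (K l) ⋯< K c ++ K′ c ⋯< K′ l

  positions-split : ∀ {a l c} → a ≤ l → l < c → c ≤ suc m →
    positions a c ≡ K a ⋯< K l ++ K l ∷ between l c ++ K′ l ⋯ K′ a
  positions-split {a} {l} {c} a≤l l<c c≤ = begin
    K a ⋯< K c ++ K′ c ⋯ K′ a
      ≡⟨ cong₂ _++_ (sym (⋯<-++-⋯< (K-mono-≤ a≤l l≤) (K-mono-≤ (<⇒≤ l<c) c≤)))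
                    (sym (⋯<-++-⋯ (K′-anti (<⇒≤ l<c) c≤) (K′-anti a≤l l≤))) ⟩
    (K a ⋯< K l ++ K l ⋯< K c) ++ K′ c ⋯< K′ l ++ K′ l ⋯ K′ a
      ≡⟨ ++-assoc (K a ⋯< K l) _ _ ⟩
    K a ⋯< K l ++ K l ⋯< K c ++ K′ c ⋯< K′ l ++ K′ l ⋯ K′ a
      ≡⟨ cong (λ xs → K a ⋯< K l ++ xs ++ K′ c ⋯< K′ l ++ K′ l ⋯ K′ a) (⋯<-head (K-mono l<c c≤)) ⟩
    K a ⋯< K l ++ K l ∷ suc (K l) ⋯< K c ++ K′ c ⋯< K′ l ++ K′ l ⋯ K′ a
      ≡⟨ cong (λ xs → K a ⋯< K l ++ K l ∷ xs) (sym (++-assoc (suc (K l) ⋯< K c) _ _)) ⟩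
    K a ⋯< K l ++ K l ∷ between l c ++ K′ l ⋯ K′ a ∎
    where
    open ≡-Reasoning
    l≤ : l ≤ suc m
    l≤ = ≤-trans (<⇒≤ l<c) c≤

  positions-self : ∀ {l c} → l < c → c ≤ suc m → positions l c ≡ K l ∷ between l c ++ [ K′ l ]
  positions-self {l} {c} l<c c≤ = trans (positions-split ≤-refl l<c c≤)
    (cong₂ (λ xs d → xs ++ K l ∷ between l c ++ K′ l ∷ iterate suc (suc (K′ l)) d)
           (⋯<-empty (K l)) (n∸n≡0 (K′ l)))

  walk-split : ∀ {a l c} → a ≤ l → l < c → c ≤ suc m →
    walk a c ≡ map v (K a ⋯< K l) ++ v (K l) ∷ map v (between l c) ++ v (K l) ∷ map v (suc (K′ l) ⋯< suc (K′ a))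
  walk-split {a} {l} {c} a≤l l<c c≤ = begin
    walk a c
      ≡⟨ cong (map v) (positions-split a≤l l<c c≤) ⟩
    map v (K a ⋯< K l ++ K l ∷ between l c ++ K′ l ⋯ K′ a)
      ≡⟨ map-++ v (K a ⋯< K l) _ ⟩
    map v (K a ⋯< K l) ++ v (K l) ∷ map v (between l c ++ K′ l ⋯ K′ a)
      ≡⟨ cong (λ xs → map v (K a ⋯< K l) ++ v (K l) ∷ xs) (map-++ v (between l c) _) ⟩
    map v (K a ⋯< K l) ++ v (K l) ∷ map v (between l c) ++ v (K′ l) ∷ map v (suc (K′ l) ⋯< suc (K′ a))
      ≡⟨ cong (λ x → map v (K a ⋯< K l) ++ v (K l) ∷ map v (between l c) ++ x ∷ map v (suc (K′ l) ⋯< suc (K′ a)))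
              (sym (match (s≤s⁻¹ (≤-trans l<c c≤)))) ⟩
    map v (K a ⋯< K l) ++ v (K l) ∷ map v (between l c) ++ v (K l) ∷ map v (suc (K′ l) ⋯< suc (K′ a)) ∎
    where open ≡-Reasoning

  -- Of the two visits to level `l`, `positions` retains the one at `K′ l`; `match` rewrites its
  -- vertex so that the walk takes the form of an internal reduction.
  walk-outer : ∀ a {l} → l ≤ m → walk a l ≡ map v (K a ⋯< K l) ++ v (K l) ∷ map v (suc (K′ l) ⋯< suc (K′ a))
  walk-outer a {l} l≤m = trans (map-++ v (K a ⋯< K l) _)
    (cong (λ x → map v (K a ⋯< K l) ++ x ∷ map v (suc (K′ l) ⋯< suc (K′ a))) (sym (match l≤m)))

  walk-inner : ∀ {l c} → l < c → c ≤ suc m → walk l c ≡ v (K l) ∷ map v (between l c) ++ [ v (K l) ]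
  walk-inner {l} {c} l<c c≤ = begin
    walk l c                                         ≡⟨ cong (map v) (positions-self l<c c≤) ⟩
    v (K l) ∷ map v (between l c ++ [ K′ l ])        ≡⟨ cong (v (K l) ∷_) (map-++ v (between l c) _) ⟩
    v (K l) ∷ map v (between l c) ++ [ v (K′ l) ]    ≡⟨ cong (λ x → v (K l) ∷ map v (between l c) ++ [ x ])
                                                             (sym (match (s≤s⁻¹ (≤-trans l<c c≤)))) ⟩
    v (K l) ∷ map v (between l c) ++ [ v (K l) ]     ∎
    where open ≡-Reasoning

  private
    proper : ∀ {a l} {Q : List V} → a < l → l ≤ suc m → ¬ (map v (K a ⋯< K l) ≡ [] × Q ≡ [])
    proper a<l l≤ (≡[] , _) with () ← trans (sym (cong (map v) (⋯<-head (K-mono a<l l≤)))) ≡[]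

  walk-↝-outer : ∀ {a l c} → a < l → l < c → c ≤ suc m → walk a c ↝ walk a l
  walk-↝-outer {a} {l} {c} a<l l<c c≤ =
    subst₂ _↝_ (sym (walk-split (<⇒≤ a<l) l<c c≤)) (sym (walk-outer a (s≤s⁻¹ (≤-trans l<c c≤))))
      (int _ _ (map v (between l c)) _ (proper a<l (≤-trans (<⇒≤ l<c) c≤)))

  walk-↝-inner : ∀ {a l c} → a < l → l < c → c ≤ suc m → walk a c ↝ walk l c
  walk-↝-inner {a} {l} {c} a<l l<c c≤ =
    subst₂ _↝_ (sym (walk-split (<⇒≤ a<l) l<c c≤)) (sym (walk-inner l<c c≤))
      (ext _ _ _ (map v (suc (K′ l) ⋯< suc (K′ a))) (proper a<l (≤-trans (<⇒≤ l<c) c≤)))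

  positions-sorted : ∀ {a c} → a < c → c ≤ suc m → AllPairs _<_ (positions a c)
  positions-sorted {a} {c} a<c c≤ = AllPairs.++⁺ (iterate-suc-sorted _ _) (iterate-suc-sorted _ _)
    (All.map (λ (_ , x<) → All.map (λ (≤y , _) → <-≤-trans x< (≤-trans (K≤K′ c≤ c≤) ≤y))
                                   (⋯-bounds (K′-anti (<⇒≤ a<c) c≤)))
             (⋯<-bounds (K a) (K c)))

  positions-bounds : ∀ {a c} → a < c → c ≤ suc m →
    All (λ p → K a ≤ p × p ≤ K′ a × (p < K c ⊎ K′ c ≤ p)) (positions a c)
  positions-bounds {a} {c} a<c c≤ = All.++⁺
    (All.map (λ (≤x , x<) → ≤x , ≤-trans (<⇒≤ x<) (K≤K′ c≤ a≤) , inj₁ x<) (⋯<-bounds (K a) (K c)))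
    (All.map (λ (≤x , x≤) → ≤-trans (K≤K′ a≤ c≤) ≤x , x≤ , inj₂ ≤x) (⋯-bounds (K′-anti (<⇒≤ a<c) c≤)))
    where
    a≤ : a ≤ suc m
    a≤ = ≤-trans (<⇒≤ a<c) c≤

  K-reflects-≤ : ∀ {i j} → i ≤ suc m → K i ≤ K j → i ≤ j
  K-reflects-≤ {i} {j} i≤ Ki≤Kj with <-≤-connex j i
  ... | inj₁ j<i = contradiction Ki≤Kj (<⇒≱ (K-mono j<i i≤))
  ... | inj₂ i≤j = i≤j

  -- The two occurrences of `x` sit at positions i < j of the original circuit, where `only` forces
  -- i = `K l` and j = `K′ l` for some level `l`. Positions being sorted, these two entries then
  -- determine all three remaining pieces.
  walk-split⁻ : ∀ {a c} P {x} R {Q} → a < c → c ≤ suc m → walk a c ≡ P ++ x ∷ R ++ x ∷ Q →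
    ∃ λ l → a ≤ l × l < c × P ≡ map v (K a ⋯< K l) × x ≡ v (K l) × R ≡ map v (between l c) ×
            Q ≡ map v (suc (K′ l) ⋯< suc (K′ a))
  walk-split⁻ {a} {c} P {x} R {Q} a<c c≤ eq
    with P′ , i , S , pos≡ , refl , refl , S≡ ← map-split v (positions a c) P eq
    with R′ , j , Q′ , refl , refl , vi≡vj , refl ← map-split v S R (sym S≡)
    = result
    where
    sorted : AllPairs _<_ (P′ ++ i ∷ R′ ++ j ∷ Q′)
    sorted = subst (AllPairs _<_) pos≡ (positions-sorted a<c c≤)
    bounds = subst (All _) pos≡ (positions-bounds a<c c≤)
    i<j : i < j
    i<j = All.head (All.++⁻ʳ R′ (sorted-after P′ sorted))
    boundsᵢ = All.head (All.++⁻ʳ P′ bounds)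
    boundsⱼ = All.head (All.++⁻ʳ R′ (All.tail (All.++⁻ʳ P′ bounds)))
    result : ∃ λ l → a ≤ l × l < c × map v P′ ≡ map v (K a ⋯< K l) × v i ≡ v (K l) ×
               map v R′ ≡ map v (between l c) × map v Q′ ≡ map v (suc (K′ l) ⋯< suc (K′ a))
    result with only i<j (≤-trans (proj₁ (proj₂ boundsⱼ)) (K′≤n (≤-trans (<⇒≤ a<c) c≤))) vi≡vj
    ... | l , l≤m , refl , refl = l , a≤l , l<c , cong (map v) P≡ , refl , cong (map v) R≡ , cong (map v) Q≡
      where
      a≤l : a ≤ l
      a≤l = K-reflects-≤ (≤-trans (<⇒≤ a<c) c≤) (proj₁ boundsᵢ)
      l<c : l < c
      -- `K l` survives in `positions a c` either before the gap or after it; the latter would put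
      -- some `K` at or beyond a `K′`.
      l<c with proj₂ (proj₂ boundsᵢ)
      ... | inj₁ Kl<Kc  = ≰⇒> λ c≤l → <⇒≱ Kl<Kc (K-mono-≤ c≤l (m≤n⇒m≤1+n l≤m))
      ... | inj₂ K′c≤Kl = contradiction K′c≤Kl (<⇒≱ (K<K′ l≤m c≤))
      splitᵢ = sorted-split-unique P′ (K a ⋯< K l) sorted (trans (sym pos≡) (positions-split a≤l l<c c≤))
      P≡ = proj₁ splitᵢ
      sortedⱼ : AllPairs _<_ ((P′ ++ K l ∷ R′) ++ K′ l ∷ Q′)
      sortedⱼ = subst (AllPairs _<_) (sym (++-assoc P′ (K l ∷ R′) _)) sorted
      splitⱼ = sorted-split-unique (P′ ++ K l ∷ R′) (P′ ++ K l ∷ between l c) sortedⱼ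
        (trans (++-assoc P′ (K l ∷ R′) _)
          (trans (cong (λ xs → P′ ++ K l ∷ xs) (proj₂ splitᵢ)) (sym (++-assoc P′ (K l ∷ between l c) _))))
      R≡ : R′ ≡ between l c
      R≡ = ∷-injectiveʳ (++-cancelˡ P′ _ _ (proj₁ splitⱼ))
      Q≡ : Q′ ≡ suc (K′ l) ⋯< suc (K′ a)
      Q≡ = proj₂ splitⱼ

  -- A walk never reduces to an empty range of levels, since cutting it at its
  -- own base level would remove everything.
  walk-↝ : ∀ {a c ys xs} → a < c → c ≤ suc m → xs ≡ walk a c → xs ↝ ys →
    ∃₂ λ a′ c′ → a ≤ a′ × a′ < c′ × c′ ≤ c × ys ≡ walk a′ c′
  walk-↝ {a} {c} a<c c≤ eq (ext P x R Q _)
    with l , a≤l , l<c , _ , refl , refl , _ ← walk-split⁻ P R a<c c≤ (sym eq) =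
    l , c , a≤l , l<c , ≤-refl , sym (walk-inner l<c c≤)
  walk-↝ {a} {c} a<c c≤ eq (int P x R Q ne)
    with walk-split⁻ P R a<c c≤ (sym eq)
  ... | l , a≤l , l<c , refl , refl , _ , refl with m≤n⇒m<n∨m≡n a≤l
  ...   | inj₁ a<l  = a , l , ≤-refl , a<l , <⇒≤ l<c , sym (walk-outer a (s≤s⁻¹ (≤-trans l<c c≤)))
  ...   | inj₂ refl = contradiction
    (cong (map v) (⋯<-empty (K a)) , cong (map v) (⋯<-empty (suc (K′ a)))) ne

  walk-⟶* : ∀ {γ δ a c} → a < c → c ≤ suc m → list γ ≡ walk a c → γ ⟶* δ →
    ∃₂ λ a′ c′ → a ≤ a′ × a′ < c′ × c′ ≤ c × list δ ≡ walk a′ c′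
  walk-⟶* {a = a} {c} a<c c≤ γ≡ ε = a , c , ≤-refl , a<c , ≤-refl , γ≡
  walk-⟶* a<c c≤ γ≡ (r ◅ rs)
    with a₁ , c₁ , a≤a₁ , a₁<c₁ , c₁≤c , δ≡ ← walk-↝ a<c c≤ γ≡ (⟶⇒↝ r)
    with a₂ , c₂ , a₁≤a₂ , a₂<c₂ , c₂≤c₁ , ζ≡ ← walk-⟶* a₁<c₁ (≤-trans c₁≤c c≤) δ≡ rs =
    a₂ , c₂ , ≤-trans a≤a₁ a₁≤a₂ , a₂<c₂ , ≤-trans c₂≤c₁ c₁≤c , ζ≡

  walk-head : ∀ {a c} → a < c → c ≤ suc m →
    walk a c ≡ v (K a) ∷ map v (suc (K a) ⋯< K c ++ K′ c ⋯ K′ a)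
  walk-head {a} {c} a<c c≤ = cong (λ xs → map v (xs ++ K′ c ⋯ K′ a)) (⋯<-head (K-mono a<c c≤))

  walkSequence : ∀ {a c} → a < c → c ≤ suc m → ∃ λ δ → list δ ≡ walk a c
  walkSequence {a} {c} a<c c≤ =
    mk _ (v (K a) ∷ fromList tail) , trans (cong (v (K a) ∷_) (toList∘fromList tail)) (sym (walk-head a<c c≤))
    where tail = map v (suc (K a) ⋯< K c ++ K′ c ⋯ K′ a)

  -- At most two reductions suffice: an external one at level `a′`, then an internal one at level
  -- `c′`. Either is omitted when its end of the interval does not move.
  walk-reduces : ∀ {a c a′ c′ γ δ} → list γ ≡ walk a c → list δ ≡ walk a′ c′ →
    a ≤ a′ → a′ < c′ → c′ ≤ c → c ≤ suc m → γ ⟶* δ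
  walk-reduces {a} {c} {a′} {c′} {γ} {δ} γ≡ δ≡ a≤a′ a′<c′ c′≤c c≤
    with ε₁ , ε≡ ← walkSequence (<-≤-trans a′<c′ c′≤c) c≤ = inner ◅◅ outer
    where
    inner : γ ⟶* ε₁
    inner with m≤n⇒m<n∨m≡n a≤a′
    ... | inj₁ a<a′ = ↝⇒⟶ γ≡ ε≡ (walk-↝-inner a<a′ (<-≤-trans a′<c′ c′≤c) c≤) ◅ ε
    ... | inj₂ refl with refl ← list-injective {γ = γ} {ε₁} (trans γ≡ (sym ε≡)) = ε
    outer : ε₁ ⟶* δ
    outer with m≤n⇒m<n∨m≡n c′≤c
    ... | inj₁ c′<c = ↝⇒⟶ ε≡ δ≡ (walk-↝-outer a′<c′ c′<c c≤) ◅ ε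
    ... | inj₂ refl with refl ← list-injective {γ = ε₁} {δ} (trans ε≡ (sym δ≡)) = ε

  -- A coincidence would be a repetition, making `K j` equal to some `K′ l`; but every `K` of level
  -- at most m precedes every `K′`.
  v∘K-injective-< : ∀ {i j} → i < j → j ≤ m → v (K i) ≢ v (K j)
  v∘K-injective-< i<j j≤m eq
    with l , l≤m , _ , Kj≡K′l ← only (K-mono i<j (m≤n⇒m≤1+n j≤m))
                                     (≤-trans (K≤K′ (m≤n⇒m≤1+n j≤m) z≤n) (K′≤n z≤n)) eq =
    <⇒≢ (K<K′ j≤m (m≤n⇒m≤1+n l≤m)) Kj≡K′l

  -- If the two agreed, the sequence tracing them would reduce internally to itself, while every
  -- reduction strictly shortens.
  walk-shorter : ∀ {a c c′} → a < c → c < c′ → c′ ≤ suc m → walk a c ≢ walk a c′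
  walk-shorter a<c c<c′ c′≤ eq
    with γ , γ≡ ← walkSequence (<-trans a<c c<c′) c′≤ =
    <-irrefl refl (⟶⇒< (↝⇒⟶ γ≡ (trans γ≡ (sym eq)) (walk-↝-outer a<c c<c′ c′≤)))

  -- The first vertex determines `a`, and then the length determines `c`. This makes the code of a
  -- walk independent of the reductions that led to it.
  walk-injective : ∀ {a c a′ c′} → a < c → c ≤ suc m → a′ < c′ → c′ ≤ suc m →
    walk a c ≡ walk a′ c′ → a ≡ a′ × c ≡ c′
  walk-injective {a} {c} {a′} {c′} a<c c≤ a′<c′ c′≤ eq
    with heads ← ∷-injectiveˡ (trans (sym (walk-head a<c c≤)) (trans eq (walk-head a′<c′ c′≤)))
    with <-cmp a a′ | <-cmp c c′
  ... | tri< a<a′ _ _ | _ = contradiction heads (v∘K-injective-< a<a′ (s≤s⁻¹ (≤-trans a′<c′ c′≤)))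
  ... | tri> _ _ a′<a | _ = contradiction (sym heads) (v∘K-injective-< a′<a (s≤s⁻¹ (≤-trans a<c c≤)))
  ... | tri≈ _ refl _ | tri< c<c′ _ _ = contradiction eq (walk-shorter a<c c<c′ c′≤)
  ... | tri≈ _ refl _ | tri> _ _ c′<c = contradiction (sym eq) (walk-shorter a′<c′ c′<c c≤)
  ... | tri≈ _ refl _ | tri≈ _ refl _ = refl , refl

-- Binary sequences

-- A canonical representative of the class with `p` ones and `q` zeros.
code : ℕ → ℕ → List Bool
code p q = replicate p true ++ replicate q false

length-code : ∀ p q → length (code p q) ≡ p + q
length-code p q = trans (length-++ (replicate p true)) (cong₂ _+_ (length-replicate p) (length-replicate q))

ones-code : ∀ p q → ones (code p q) ≡ p
ones-code (suc p) q       = cong suc (ones-code p q)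
ones-code zero    zero    = refl
ones-code zero    (suc q) = ones-code zero q

ones-++ : ∀ s t → ones (s ++ t) ≡ ones s + ones t
ones-++ s t = trans (cong length (filter-++ _ s t)) (length-++ (filterᵇ id s))

module _ {m : ℕ} where

  -- In general `code p q` is not an initial segment of `code p′ q′`. Appending the missing letters
  -- to it gives a sequence equivalent to the latter, which is enough.
  code-≼ : ∀ {p q p′ q′} (h : length (code p q) ≤ m) (h′ : length (code p′ q′) ≤ m) →
    p ≤ p′ → q ≤ q′ → _≼_ {m} (code p′ q′ , h′) (code p q , h)
  code-≼ {p} {q} {p′} {q′} h h′ p≤p′ q≤q′ =
    (code p q ++ r , subst (_≤ m) (sym length≡) h′) , (code p q , h) ,
    (length≡ , ones≡) , (refl , refl) , fromPointwise (Pointwise.refl refl) ++ᵖ r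
    where
    open ≡-Reasoning
    r = code (p′ ∸ p) (q′ ∸ q)
    length≡ : length (code p q ++ r) ≡ length (code p′ q′)
    length≡ = begin
      length (code p q ++ r)             ≡⟨ length-++ (code p q) ⟩
      length (code p q) + length r       ≡⟨ cong₂ _+_ (length-code p q) (length-code (p′ ∸ p) (q′ ∸ q)) ⟩
      p + q + (p′ ∸ p + (q′ ∸ q))        ≡⟨ +-assoc-middle p q (p′ ∸ p) (q′ ∸ q) ⟩
      (p + (p′ ∸ p)) + (q + (q′ ∸ q))    ≡⟨ cong₂ _+_ (m+[n∸m]≡n p≤p′) (m+[n∸m]≡n q≤q′) ⟩
      p′ + q′                            ≡⟨ sym (length-code p′ q′) ⟩
      length (code p′ q′)                ∎
      where
      +-assoc-middle : ∀ w x y z → w + x + (y + z) ≡ (w + y) + (x + z)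
      +-assoc-middle = solve-∀
    ones≡ : ones (code p q ++ r) ≡ ones (code p′ q′)
    ones≡ = begin
      ones (code p q ++ r)        ≡⟨ ones-++ (code p q) r ⟩
      ones (code p q) + ones r    ≡⟨ cong₂ _+_ (ones-code p q) (ones-code (p′ ∸ p) (q′ ∸ q)) ⟩
      p + (p′ ∸ p)                ≡⟨ m+[n∸m]≡n p≤p′ ⟩
      p′                          ≡⟨ sym (ones-code p′ q′) ⟩
      ones (code p′ q′)           ∎

  -- The second component says that t has at most as many 0's as s.
  ≼⇒≤ : ∀ {s t : 2^≤ m} → s ≼ t → ones (proj₁ t) ≤ ones (proj₁ s) ×
    length (proj₁ t) + ones (proj₁ s) ≤ length (proj₁ s) + ones (proj₁ t)
  ≼⇒≤ ((_ , _) , (t′ , _) , (len-s , ones-s) , (len-t , ones-t) , t′⊑s′) with toView t′⊑s′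
  ... | t≡ ⧺ r with refl ← Pointwise-≡⇒≡ t≡
      rewrite sym len-s | sym ones-s | sym len-t | sym ones-t | ones-++ t′ r | length-++ t′ {r} =
    m≤m+n _ _ , (begin
      length t′ + (ones t′ + ones r)      ≤⟨ +-monoʳ-≤ (length t′) (+-monoʳ-≤ (ones t′) (length-filter _ r)) ⟩
      length t′ + (ones t′ + length r)    ≡⟨ cong (length t′ +_) (+-comm (ones t′) _) ⟩
      length t′ + (length r + ones t′)    ≡⟨ sym (+-assoc (length t′) _ _) ⟩
      length t′ + length r + ones t′      ∎)
    where open ≤-Reasoning

  code-≼⁻ : ∀ {p q p′ q′} (h : length (code p q) ≤ m) (h′ : length (code p′ q′) ≤ m) →
    _≼_ {m} (code p′ q′ , h′) (code p q , h) → p ≤ p′ × q ≤ q′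
  code-≼⁻ {p} {q} {p′} {q′} h h′ s≼t with ≼⇒≤ {code p′ q′ , h′} {code p q , h} s≼t
  ... | ones≤ , zeros≤
    rewrite ones-code p q | ones-code p′ q′ | length-code p q | length-code p′ q′ =
    ones≤ , +-cancelʳ-≤ (p + p′) q q′ (subst₂ _≤_ (lhs p q p′) (rhs p′ q′ p) zeros≤)
    where
    lhs : ∀ p q p′ → p + q + p′ ≡ q + (p + p′)
    lhs = solve-∀
    rhs : ∀ p′ q′ p → p′ + q′ + p ≡ q′ + (p + p′)
    rhs = solve-∀

-- From indices to positions

-- Made total by repeating the last entry; the positions of the walks considered never exceed `n γ`.
nth : ∀ {k} → Vec A (suc k) → ℕ → A
nth (x ∷ _)      zero    = x
nth (x ∷ [])     (suc _) = x
nth (_ ∷ y ∷ vs) (suc p) = nth (y ∷ vs) p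

nth-toℕ : ∀ {k} (vs : Vec A (suc k)) i → nth vs (toℕ i) ≡ lookup vs i
nth-toℕ (_ ∷ _)      zero    = refl
nth-toℕ (_ ∷ y ∷ vs) (suc i) = nth-toℕ (y ∷ vs) i

map-iterate-suc : ∀ (f : ℕ → A) p d → map f (iterate suc (suc p) d) ≡ map (f ∘ suc) (iterate suc p d)
map-iterate-suc f p zero    = refl
map-iterate-suc f p (suc d) = cong (f (suc p) ∷_) (map-iterate-suc f (suc p) d)

map-nth : ∀ {k} (vs : Vec A (suc k)) → map (nth vs) (0 ⋯ k) ≡ toList vs
map-nth {k = zero}  (x ∷ [])     = refl
map-nth {k = suc k} (x ∷ y ∷ vs) =
  cong (x ∷_) (trans (map-iterate-suc (nth (x ∷ y ∷ vs)) 0 (suc k)) (map-nth (y ∷ vs)))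

extend : ∀ {m} → (Fin (suc m) → A) → A → ℕ → A
extend {m = m} f t l with l ≤? m
... | yes l≤m = f (fromℕ< (s≤s l≤m))
... | no  _   = t

extend-toℕ : ∀ {m} (f : Fin (suc m) → A) t i → extend f t (toℕ i) ≡ f i
extend-toℕ {m = m} f t i with toℕ i ≤? m
... | yes i≤m = cong f (toℕ-injective (toℕ-fromℕ< (s≤s i≤m)))
... | no  i≰m = contradiction (s≤s⁻¹ (toℕ<n i)) i≰m

extend-suc : ∀ {m} (f : Fin (suc m) → A) t → extend f t (suc m) ≡ t
extend-suc {m = m} f t with suc m ≤? m
... | yes 1+m≤m = contradiction 1+m≤m 1+n≰n
... | no  _     = refl

≤⇒toℕ : ∀ {l m} → l ≤ m → ∃ λ (i : Fin (suc m)) → toℕ i ≡ l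
≤⇒toℕ l≤m = fromℕ< (s≤s l≤m) , toℕ-fromℕ< (s≤s l≤m)

module _ {V : Set a} (γ : VertexSequence V) (closed : at γ zero ≡ at γ (fromℕ (n γ)))
         {m : ℕ} (I : NestedIndices γ m) where
  open NestedIndices I

  k-mono-≤ : ∀ {i j} → i Fin.≤ j → k i Fin.≤ k j
  k-mono-≤ i≤j with m≤n⇒m<n∨m≡n i≤j
  ... | inj₁ i<j = <⇒≤ (k-mono i<j)
  ... | inj₂ i≡j = ≤-reflexive (cong (toℕ ∘ k) (toℕ-injective i≡j))

  k′-anti-≤ : ∀ {i j} → i Fin.≤ j → k′ j Fin.≤ k′ i
  k′-anti-≤ i≤j with m≤n⇒m<n∨m≡n i≤j
  ... | inj₁ i<j = <⇒≤ (k′-anti i<j)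
  ... | inj₂ i≡j = ≤-reflexive (cong (toℕ ∘ k′) (sym (toℕ-injective i≡j)))

  k<k′top : ∀ i → k i Fin.< k′ (fromℕ m)
  k<k′top i = ≤-<-trans (k-mono-≤ (≤fromℕ i)) middle

  k<k′ : ∀ i → k i Fin.< k′ i
  k<k′ i = <-≤-trans (k<k′top i) (k′-anti-≤ (≤fromℕ i))

  k-matches-k′ : ∀ i → at γ (k i) ≡ at γ (k′ i)
  k-matches-k′ zero    = trans (cong (at γ) k-start) (trans closed (cong (at γ) (sym k′-end)))
  k-matches-k′ (suc i) = intersection i

  -- If q = n or p = 0, the vertex is the base vertex, which is met only at the two ends. Otherwise
  -- (p, q) is an intersection, so the vertex is some v at `k (suc i)`; `only` leaves two places for
  -- each of p and q, and p < q decides which is which.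
  repetition-is-level : ∀ p q → p Fin.< q → at γ p ≡ at γ q → ∃ λ i → p ≡ k i × q ≡ k′ i
  repetition-is-level p q p<q p≡q with q ≟ᶠ fromℕ (n γ)
  ... | yes refl with only zero p (trans p≡q (trans (sym closed) (cong (at γ) (sym k-start))))
  ...   | inj₁ p≡k₀  = zero , p≡k₀ , sym k′-end
  ...   | inj₂ p≡k′₀ = contradiction (trans p≡k′₀ k′-end) (λ p≡n → <⇒≢ p<q (cong toℕ p≡n))
  repetition-is-level zero q p<q p≡q | no _
    with only zero q (trans (sym p≡q) (cong (at γ) (sym k-start)))
  ...   | inj₁ q≡k₀  = contradiction (cong toℕ (sym (trans q≡k₀ k-start))) (<⇒≢ p<q)
  ...   | inj₂ q≡k′₀ = zero , sym k-start , q≡k′₀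
  repetition-is-level p@(suc _) q p<q p≡q | no q≢n
    with i , p≡kᵢ ← Equivalence.to (internalVertices (at γ p))
           (p , q , (s≤s z≤n , p<q , ≤∧≢⇒< (≤fromℕ q) (q≢n ∘ toℕ-injective) , p≡q) , refl , p≡q)
    with only (suc i) p p≡kᵢ | only (suc i) q (trans (sym p≡q) p≡kᵢ)
  ...   | inj₁ p≡k  | inj₂ q≡k′ = suc i , p≡k , q≡k′
  ...   | inj₁ p≡k  | inj₁ q≡k  = contradiction (cong toℕ (trans p≡k (sym q≡k))) (<⇒≢ p<q)
  ...   | inj₂ p≡k′ | inj₂ q≡k′ = contradiction (cong toℕ (trans p≡k′ (sym q≡k′))) (<⇒≢ p<q)
  ...   | inj₂ p≡k′ | inj₁ q≡k  = contradiction (subst₂ Fin._<_ p≡k′ q≡k p<q) (<⇒≯ (k<k′ (suc i)))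

  private
    -- The default `k′ (fromℕ m)` is the value of both at level m + 1. The innermost part from
    -- `k (fromℕ m)` to `k′ (fromℕ m)` thus falls wholly on the side of `K`, and `K′` takes the same
    -- value at m and m + 1, so it is only weakly decreasing.
    K K′ : ℕ → ℕ
    K  = extend (toℕ ∘ k)  (toℕ (k′ (fromℕ m)))
    K′ = extend (toℕ ∘ k′) (toℕ (k′ (fromℕ m)))

    K≡ : ∀ i → K (toℕ i) ≡ toℕ (k i)
    K≡ = extend-toℕ (toℕ ∘ k) _
    K′≡ : ∀ i → K′ (toℕ i) ≡ toℕ (k′ i)
    K′≡ = extend-toℕ (toℕ ∘ k′) _
    Ktop≡ : K (suc m) ≡ toℕ (k′ (fromℕ m))
    Ktop≡ = extend-suc (toℕ ∘ k) _
    K′top≡ : K′ (suc m) ≡ toℕ (k′ (fromℕ m))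
    K′top≡ = extend-suc (toℕ ∘ k′) _

  nesting : Nesting (nth (vertices γ)) (n γ) m
  nesting = record
    { K = K ; K′ = K′
    ; K-start = trans (K≡ zero) (cong toℕ k-start)
    ; K′-end  = trans (K′≡ zero) (trans (cong toℕ k′-end) (toℕ-fromℕ (n γ)))
    ; K-mono  = mono
    ; K′-anti = anti
    ; K-top   = trans Ktop≡ (sym K′top≡)
    ; match   = matching
    ; only    = level
    }
    where
    mono : ∀ {i j} → i < j → j ≤ suc m → K i < K j
    mono i<j j≤ with i , refl ← ≤⇒toℕ (s≤s⁻¹ (≤-trans i<j j≤)) with m≤n⇒m<n∨m≡n j≤
    ... | inj₂ refl = subst₂ _<_ (sym (K≡ i)) (sym Ktop≡) (k<k′top i)
    ... | inj₁ (s≤s j≤m) with j , refl ← ≤⇒toℕ j≤m = subst₂ _<_ (sym (K≡ i)) (sym (K≡ j)) (k-mono i<j)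
    anti : ∀ {i j} → i ≤ j → j ≤ suc m → K′ j ≤ K′ i
    anti i≤j j≤ with m≤n⇒m<n∨m≡n i≤j
    ... | inj₂ refl = ≤-refl
    ... | inj₁ i<j with i , refl ← ≤⇒toℕ (s≤s⁻¹ (≤-trans i<j j≤)) with m≤n⇒m<n∨m≡n j≤
    ...   | inj₂ refl = subst₂ _≤_ (sym K′top≡) (sym (K′≡ i)) (k′-anti-≤ (≤fromℕ i))
    ...   | inj₁ (s≤s j≤m) with j , refl ← ≤⇒toℕ j≤m =
      subst₂ _≤_ (sym (K′≡ j)) (sym (K′≡ i)) (k′-anti-≤ i≤j)
    matching : ∀ {l} → l ≤ m → nth (vertices γ) (K l) ≡ nth (vertices γ) (K′ l)
    matching l≤m with i , refl ← ≤⇒toℕ l≤m rewrite K≡ i | K′≡ i =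
      trans (nth-toℕ (vertices γ) (k i)) (trans (k-matches-k′ i) (sym (nth-toℕ (vertices γ) (k′ i))))
    level : ∀ {p q} → p < q → q ≤ n γ → nth (vertices γ) p ≡ nth (vertices γ) q →
            ∃ λ l → l ≤ m × p ≡ K l × q ≡ K′ l
    level p<q q≤n eq
      with p , refl ← ≤⇒toℕ (≤-trans (<⇒≤ p<q) q≤n) | q , refl ← ≤⇒toℕ q≤n
      with i , refl , refl ← repetition-is-level p q p<q
             (trans (sym (nth-toℕ (vertices γ) p)) (trans eq (nth-toℕ (vertices γ) q)))
      = toℕ i , s≤s⁻¹ (toℕ<n i) , sym (K≡ i) , sym (K′≡ i)

-- The number of internal vertices.

-- Both `enum` and the vertices at `k (suc j)` list the internal vertices without repetition;
-- matching them gives injections between `Fin m` and `Fin m′` in both directions.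
internalVertices-unique : {V : Set a} {γ : VertexSequence V} {m m′ : ℕ} →
  HasInternalVertices γ m → NestedIndices γ m′ → m ≡ m′
internalVertices-unique {γ = γ} H I =
  cantor-schröder-bernstein (λ {i} {j} → f-injective i j) (λ {i} {j} → g-injective i j)
  where
  open HasInternalVertices H
  open NestedIndices I
  f : ∀ i → ∃ λ j → enum i ≡ at γ (k (suc j))
  f i = Equivalence.to (internalVertices (enum i)) (Equivalence.from (complete (enum i)) (i , refl))
  g : ∀ j → ∃ λ i → at γ (k (suc j)) ≡ enum i
  g j = Equivalence.to (complete _) (Equivalence.from (internalVertices _) (j , refl))
  f-injective : ∀ i i′ → proj₁ (f i) ≡ proj₁ (f i′) → i ≡ i′
  f-injective i i′ eq =
    injective (trans (proj₂ (f i)) (trans (cong (at γ ∘ k ∘ suc) eq) (sym (proj₂ (f i′)))))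
  g-injective : ∀ j j′ → proj₁ (g j) ≡ proj₁ (g j′) → j ≡ j′
  -- `distinct` only refutes equality of vertices, so equality of the indices is decided first.
  g-injective j j′ eq with j ≟ᶠ j′
  ... | yes j≡j′ = j≡j′
  ... | no  j≢j′ = contradiction (trans (proj₂ (g j)) (trans (cong enum eq) (sym (proj₂ (g j′)))))
                                 (distinct (j≢j′ ∘ sucᶠ-injective))

-- The isomorphism

module _ {V : Set a} {γ : VertexSequence V} {m : ℕ} {v : ℕ → V} (N : Nesting v (n γ) m)
         (γ≡ : list γ ≡ walk N 0 (suc m)) where

  Levels : VertexSequence V → Set a
  Levels δ = ∃₂ λ a c → a < c × c ≤ suc m × list δ ≡ walk N a c

  levels : ∀ {δ} → γ ⟶* δ → Levels δ
  levels rs with a , c , _ , a<c , c≤ , δ≡ ← walk-⟶* N (s≤s z≤n) ≤-refl γ≡ rs = a , c , a<c , c≤ , δ≡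

  -- The length bound is exactly nonemptiness: a < c says that fewer than m + 1 levels are removed.
  toCode : ∀ {δ} → Levels δ → 2^≤ m
  toCode (a , c , a<c , c≤ , _) = code a (suc m ∸ c) , s≤s⁻¹ (begin
    suc (length (code a (suc m ∸ c)))    ≡⟨ cong suc (length-code a (suc m ∸ c)) ⟩
    suc a + (suc m ∸ c)                  ≤⟨ +-monoˡ-≤ (suc m ∸ c) a<c ⟩
    c + (suc m ∸ c)                      ≡⟨ m+[n∸m]≡n c≤ ⟩
    suc m                                ∎)
    where open ≤-Reasoning

  toCode-cong : ∀ {δ ε} (x : Levels δ) (y : Levels ε) → δ ≡ ε → _∼_ {m} (toCode x) (toCode y)
  toCode-cong (a , c , a<c , c≤ , δ≡) (a′ , c′ , a′<c′ , c′≤ , ε≡) refl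
    with refl , refl ← walk-injective N a<c c≤ a′<c′ c′≤ (trans (sym δ≡) ε≡) = refl , refl

  toCode-mono : ∀ {δ ε} (x : Levels δ) (y : Levels ε) → ε ⟶* δ → _≼_ {m} (toCode x) (toCode y)
  toCode-mono x@(a , c , a<c , c≤ , δ≡) y@(a′ , c′ , a′<c′ , c′≤ , ε≡) rs
    with a″ , c″ , a′≤a″ , a″<c″ , c″≤c′ , δ≡″ ← walk-⟶* N a′<c′ c′≤ ε≡ rs
    -- The levels found along `rs` need not be those stored in `x`; injectivity identifies them.
    with refl , refl ← walk-injective N a<c c≤ a″<c″ (≤-trans c″≤c′ c′≤) (trans (sym δ≡) δ≡″) =
    code-≼ (proj₂ (toCode y)) (proj₂ (toCode x)) a′≤a″ (∸-monoʳ-≤ (suc m) c″≤c′)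

  toCode-injective : ∀ {δ ε} (x : Levels δ) (y : Levels ε) → _∼_ {m} (toCode x) (toCode y) → δ ≡ ε
  toCode-injective (a , c , a<c , c≤ , δ≡) (a′ , c′ , a′<c′ , c′≤ , ε≡) (length≡ , ones≡)
    with refl ← trans (sym (ones-code a (suc m ∸ c))) (trans ones≡ (ones-code a′ (suc m ∸ c′)))
    with refl ← ∸-cancelˡ-≡ c≤ c′≤ (+-cancelˡ-≡ a _ _
                  (trans (sym (length-code a (suc m ∸ c))) (trans length≡ (length-code a (suc m ∸ c′)))))
    = list-injective (trans δ≡ (sym ε≡))

  toCode-cancel : ∀ {δ ε} (x : Levels δ) (y : Levels ε) → _≼_ {m} (toCode x) (toCode y) → ε ⟶* δ
  toCode-cancel x@(a , c , a<c , c≤ , δ≡) y@(a′ , c′ , a′<c′ , c′≤ , ε≡) x≼y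
    with a′≤a , d′≤d ← code-≼⁻ (proj₂ (toCode y)) (proj₂ (toCode x)) x≼y =
    walk-reduces N ε≡ δ≡ a′≤a a<c (≮⇒≥ λ c′<c → ≤⇒≯ d′≤d (∸-monoʳ-< c′<c c≤)) c′≤

  toCode-surjective : ∀ s → ∃ λ δ → γ ⟶* δ × ∃ λ (x : Levels δ) → _∼_ {m} (toCode x) s
  toCode-surjective (s , s≤m) = result
    where
    p = ones s
    q = length s ∸ p
    -- `q` counts the 0's of `s`, and this `c` makes `suc m ∸ c` equal to `q`; p < c then amounts to
    -- p + q ≤ m.
    c = suc m ∸ q
    p+q≡ : p + q ≡ length s
    p+q≡ = m+[n∸m]≡n (length-filter _ s)
    p+q≤m : suc p + q ≤ suc m
    p+q≤m = s≤s (≤-trans (≤-reflexive p+q≡) s≤m)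
    p<c : p < c
    p<c = m+n≤o⇒m≤o∸n (suc p) p+q≤m
    c≤ : c ≤ suc m
    c≤ = m∸n≤m (suc m) q
    length≡ : length (code p (suc m ∸ c)) ≡ length s
    length≡ = trans (length-code p (suc m ∸ c))
      (trans (cong (p +_) (m∸[m∸n]≡n (m+n≤o⇒n≤o (suc p) p+q≤m))) p+q≡)
    result : ∃ λ δ → γ ⟶* δ × ∃ λ (x : Levels δ) → _∼_ {m} (toCode x) (s , s≤m)
    result with δ , δ≡ ← walkSequence N p<c c≤ =
      δ , walk-reduces N γ≡ δ≡ z≤n p<c c≤ ≤-refl , (p , c , p<c , c≤ , δ≡) , length≡ , ones-code p (suc m ∸ c)

  nested-isomorphic : Isomorphic (X γ) (S m)
  nested-isomorphic = toCode ∘ levelsOf , record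
    { isOrderMonomorphism = record
      { isOrderHomomorphism = record
        { cong = λ {ξ} {η} → toCode-cong (levelsOf ξ) (levelsOf η)
        ; mono = λ {ξ} {η} → toCode-mono (levelsOf ξ) (levelsOf η)
        }
      ; injective = λ {ξ} {η} → toCode-injective (levelsOf ξ) (levelsOf η)
      ; cancel    = λ {ξ} {η} → toCode-cancel (levelsOf ξ) (levelsOf η)
      }
    ; surjective = surjective
    }
    where
    module S = Poset (S m)
    levelsOf : (ξ : Reduction γ) → Levels (Reduction.δ ξ)
    levelsOf ξ = levels (Reduction.reduces ξ)
    surjective : ∀ s → ∃ λ ξ → ∀ {η} → Reduction.δ η ≡ Reduction.δ ξ → _∼_ {m} (toCode (levelsOf η)) s
    surjective s with δ , rs , x , x∼s ← toCode-surjective s =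
      mk δ (⟶*⇒⊇ rs) rs , λ {η} η≡ →
        S.Eq.trans {toCode (levelsOf η)} {toCode x} {s} (toCode-cong (levelsOf η) x η≡) x∼s

-- Simple cycles, and assembly of the two cases.

-- The only possible sub-circuit is the whole cycle, which is not proper.
simpleCycle-irreducible : {V : Set a} {γ δ : VertexSequence V} → IsSimpleCycle γ → γ ⟶* δ → γ ≡ δ
simpleCycle-irreducible simple ε = refl
simpleCycle-irreducible simple (internalReduction i j sub proper _ ◅ _) =
  contradiction (simple i j (IsSubCircuit.i<j sub) (IsSubCircuit.vᵢ≡vⱼ sub)) proper
simpleCycle-irreducible simple (externalReduction i j sub proper _ ◅ _) =
  contradiction (simple i j (IsSubCircuit.i<j sub) (IsSubCircuit.vᵢ≡vⱼ sub)) proper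

simpleCycle-isomorphic : {V : Set a} {γ : VertexSequence V} → IsSimpleCycle γ → Isomorphic (X γ) (S 0)
simpleCycle-isomorphic {γ = γ} simple = (λ _ → [] , z≤n) , record
  { isOrderMonomorphism = record
    { isOrderHomomorphism = record
      { cong = λ _ → refl , refl
      ; mono = λ _ → code-≼ {p = 0} {0} {0} {0} z≤n z≤n z≤n z≤n
      }
    ; injective = λ {ξ} {η} _ → trivial ξ η
    ; cancel    = λ {ξ} {η} _ → subst (Reduction.δ η ⟶*_) (trivial η ξ) ε
    }
  ; surjective = λ { ([] , _) → mk γ (id , id) ε , λ _ → refl , refl }
  }
  where
  trivial : ∀ (ξ η : Reduction γ) → Reduction.δ ξ ≡ Reduction.δ η
  trivial ξ η = trans (sym (simpleCycle-irreducible simple (Reduction.reduces ξ)))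
                      (simpleCycle-irreducible simple (Reduction.reduces η))

simpleCycle⇒¬internal : {V : Set a} {γ : VertexSequence V} {v : V} → IsSimpleCycle γ → ¬ InternalVertex γ v
simpleCycle⇒¬internal simple (i , j , (0<i , i<j , _ , eq) , _)
  with refl , _ ← simple i j i<j eq = <-irrefl refl 0<i

-- At level m + 1 the two sequences of positions meet, so the gap closes and nothing is cut out.
list≡walk : {V : Set a} (γ : VertexSequence V) {m : ℕ} (N : Nesting (nth (vertices γ)) (n γ) m) →
  list γ ≡ walk N 0 (suc m)
list≡walk γ {m} N = sym (begin
  map v (K 0 ⋯< K (suc m) ++ K′ (suc m) ⋯ K′ 0)    ≡⟨ cong (λ p → map v (K 0 ⋯< p ++ K′ (suc m) ⋯ K′ 0)) K-top ⟩
  map v (K 0 ⋯< K′ (suc m) ++ K′ (suc m) ⋯ K′ 0)   ≡⟨ cong (map v) (⋯<-++-⋯ (K≤K′ N z≤n ≤-refl) (K′-anti z≤n ≤-refl)) ⟩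
  map v (K 0 ⋯ K′ 0)                               ≡⟨ cong (map v) (cong₂ _⋯_ K-start K′-end) ⟩
  map v (0 ⋯ n γ)                                  ≡⟨ map-nth (vertices γ) ⟩
  list γ                                           ∎)
  where
  open ≡-Reasoning
  open Nesting N
  v = nth (vertices γ)

theorem7 : ∀ {a ℓ : Level} (G : SimpleGraph a ℓ) (γ : VertexSequence (SimpleGraph.Vertex G)) (m : ℕ) →
    IsCircuit G γ → IsPerfectlyNested γ → HasInternalVertices γ m →
    Isomorphic (X γ) (S m)
theorem7 G γ zero    circuit (inj₁ simple) H = simpleCycle-isomorphic simple
theorem7 G γ (suc m) circuit (inj₁ simple) H =
  contradiction (Equivalence.from (complete (enum zero)) (zero , refl)) (simpleCycle⇒¬internal {γ = γ} simple)
  where open HasInternalVertices H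
theorem7 G γ m circuit (inj₂ (m′ , I)) H with refl ← internalVertices-unique H I =
  nested-isomorphic N (list≡walk γ N)
  where N = nesting γ (IsClosedWalk.closed (IsCircuit.isClosedWalk circuit)) I
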